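{- For $n\ge 1$, the expected number of lucky spots of a uniformly random weakly-decreasing parking function of $1,\ldots,n$ is $\frac12(n+1)$.
   Context: There are $n$ spots labeled $1,\ldots,n$ in order along a one-way street, and $n$ cars entering one after another, car $i$ having preference $a_i\in\{1,\ldots,n\}$. Each car drives to its preferred spot and parks there if it is available; otherwise it moves forward and parks in the first available later spot, if any (if none, it fails to park). A parking function of $1,\ldots,n$ is a sequence of preferences $(a_1,\ldots,a_n)$ such that all $n$ cars are able to park; it is weakly-decreasing if $a_1\ge a_2\ge\cdots\ge a_n$. A spot is lucky if the car that parks in it prefers that spot. -}

module Defs where

open import Data.Bool.Base using (true; false)
open import Data.Fin.Base using (Fin; zero; suc; _≤_; _≥_)
open import Data.Fin.Properties using (_≟_; _≤?_; any?)
open import Data.Fin.Subset using (Subset; ⊥; ∣_∣; _∉_; inside; outside)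
open import Data.Fin.Subset.Properties using (_∈?_; ∣⊥∣≡0; drop-there)
open import Data.Integer.Base using (+_)
open import Data.List.Base using (List; []; _∷_; map; length; filter; find; allFin; cartesianProductWith)
open import Data.List.Membership.Propositional using () renaming (_∈_ to _∈ᴸ_)
open import Data.List.Membership.Propositional.Properties
  using (∈-allFin; ∈-cartesianProductWith⁺; ∈-filter⁺)
open import Data.List.Relation.Unary.Any using (here; there)
open import Data.List.Relation.Unary.Unique.Propositional using (Unique; []; _∷_)
import Data.List.Relation.Unary.All as Allᴸ
import Data.List.Relation.Unary.Unique.Propositional.Properties as Unique
open import Data.Maybe.Base using (Maybe; just; nothing)
open import Data.Maybe using (Is-just)
import Data.Maybe.Properties as Maybe
import Data.Maybe.Relation.Unary.Any as MaybeAny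
open import Data.Nat.Base as ℕ using (ℕ; zero; suc; _+_; z≤n; s≤s; NonZero)
open import Data.Nat.ListAction using (sum)
import Data.Nat.Properties as ℕ
open import Data.Product.Base using (∃; _×_; _,_)
open import Data.Rational.Base using (ℚ; _/_)
open import Data.Unit.Base using (tt)
open import Data.Vec.Base as Vec using (Vec; []; _∷_; lookup; count; replicate; _[_]≔_)
import Data.Vec.Properties as Vec
open import Data.Vec.Relation.Unary.All using (All; []; _∷_; all?)
open import Data.Vec.Relation.Unary.Linked using (Linked; []; [-]; _∷_; linked?)
open import Relation.Binary.PropositionalEquality using (_≡_; refl; cong; subst)
open import Relation.Nullary.Decidable using (yes; no; _×-dec_; ¬?)
open import Relation.Nullary.Negation using (contradiction)
open import Relation.Unary using (Decidable)

private
  variable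
    A : Set
    m n : ℕ

-- Spots 1, …, n are the elements of Fin n in increasing order.

Preferences : ℕ → Set
Preferences n = Vec (Fin n) n

firstAvailable : Subset n → Fin n → Maybe (Fin n)
firstAvailable {n} occupied a =
  find (λ j → (a ≤? j) ×-dec ¬? (j ∈? occupied)) (allFin n)

occupy : Maybe (Fin n) → Subset n → Subset n
occupy (just j) occupied = occupied [ j ]≔ inside
occupy nothing  occupied = occupied

-- The spot taken by each arriving car, or nothing for a car that fails to park.
park : Subset n → Vec (Fin n) m → Vec (Maybe (Fin n)) m
park occupied []       = []
park occupied (a ∷ as) = s ∷ park (occupy s occupied) as
  where s = firstAvailable occupied a

outcome : Preferences n → Vec (Maybe (Fin n)) n
outcome a = park ⊥ a

IsParkingFunction : Preferences n → Set
IsParkingFunction a = All Is-just (outcome a)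

WeaklyDecreasing : Preferences n → Set
WeaklyDecreasing a = Linked _≥_ a

Lucky : Preferences n → Fin n → Set
Lucky a j = ∃ λ i → lookup (outcome a) i ≡ just j × lookup a i ≡ j

lucky? : (a : Preferences n) → Decidable (Lucky a)
lucky? a j = any? λ i →
  Maybe.≡-dec _≟_ (lookup (outcome a) i) (just j) ×-dec (lookup a i ≟ j)

numLucky : Preferences n → ℕ
numLucky {n} a = count (lucky? a) (Vec.allFin n)

IsWeaklyDecreasingPF : Preferences n → Set
IsWeaklyDecreasingPF a = WeaklyDecreasing a × IsParkingFunction a

isWeaklyDecreasingPF? : Decidable (IsWeaklyDecreasingPF {n})
isWeaklyDecreasingPF? a =
  linked? (λ x y → y ≤? x) a ×-dec all? (MaybeAny.dec λ _ → yes tt) (outcome a)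

vectors : List A → (m : ℕ) → List (Vec A m)
vectors xs zero    = [] ∷ []
vectors xs (suc m) = cartesianProductWith _∷_ xs (vectors xs m)

weaklyDecreasingPFs : (n : ℕ) → List (Preferences n)
weaklyDecreasingPFs n = filter isWeaklyDecreasingPF? (vectors (allFin n) n)

-- The expectation of f under the uniform distribution on the entries of xs.
𝔼 : (f : A → ℕ) (xs : List A) .{{_ : NonZero (length xs)}} → ℚ
𝔼 f xs = + sum (map f xs) / length xs

-- The list weaklyDecreasingPFs n contains every weakly-decreasing parking
-- function, and contains it once.

vectors-complete : ∀ m (v : Vec (Fin n) m) → v ∈ᴸ vectors (allFin n) m
vectors-complete zero    []      = here refl
vectors-complete (suc m) (x ∷ v) =
  ∈-cartesianProductWith⁺ _∷_ (∈-allFin x) (vectors-complete m v)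

vectors-unique : ∀ m → Unique (vectors (allFin n) m)
vectors-unique zero    = Allᴸ.[] ∷ []
vectors-unique {n} (suc m) =
  Unique.cartesianProductWith⁺ _∷_ Vec.∷-injective (Unique.allFin⁺ n) (vectors-unique m)

weaklyDecreasingPFs-complete : (a : Preferences n) → IsWeaklyDecreasingPF a →
                               a ∈ᴸ weaklyDecreasingPFs n
weaklyDecreasingPFs-complete {n} a pa =
  ∈-filter⁺ isWeaklyDecreasingPF? (vectors-complete n a) pa

weaklyDecreasingPFs-unique : ∀ n → Unique (weaklyDecreasingPFs n)
weaklyDecreasingPFs-unique n = Unique.filter⁺ isWeaklyDecreasingPF? (vectors-unique n)

-- It is nonempty, as (1, …, 1) is a parking function.

private
  find-just : ∀ {P : A → Set} (P? : Decidable P) {x} {xs : List A} →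
              x ∈ᴸ xs → P x → Is-just (find P? xs)
  find-just P? {xs = y ∷ _} x∈ px with P? y
  find-just P? _           px | yes _  = MaybeAny.just tt
  find-just P? (here refl) px | no ¬py = contradiction px ¬py
  find-just P? (there x∈)  px | no _   = find-just P? x∈ px

  ∃-available : (p : Subset n) → ∣ p ∣ ℕ.< n → ∃ λ j → j ∉ p
  ∃-available (outside ∷ p) _       = zero , λ ()
  ∃-available (inside  ∷ p) (s≤s h) with j , j∉p ← ∃-available p h =
    suc j , λ j∈ → j∉p (drop-there j∈)

  ∣insert∣ : (p : Subset n) (j : Fin n) → ∣ p [ j ]≔ inside ∣ ℕ.≤ suc ∣ p ∣
  ∣insert∣ (outside ∷ p) zero    = ℕ.≤-refl
  ∣insert∣ (inside  ∷ p) zero    = ℕ.n≤1+n _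
  ∣insert∣ (outside ∷ p) (suc j) = ∣insert∣ p j
  ∣insert∣ (inside  ∷ p) (suc j) = s≤s (∣insert∣ p j)

  ∣occupy∣ : ∀ s (p : Subset n) → ∣ occupy s p ∣ ℕ.≤ suc ∣ p ∣
  ∣occupy∣ (just j) p = ∣insert∣ p j
  ∣occupy∣ nothing  p = ℕ.n≤1+n _

  park-zeros : ∀ m (p : Subset (suc n)) → ∣ p ∣ + m ℕ.≤ suc n →
               All Is-just (park p (replicate m zero))
  park-zeros zero    p h = []
  park-zeros {n} (suc m) p h
    with h′ ← subst (ℕ._≤ suc n) (ℕ.+-suc ∣ p ∣ m) h
    with j , j∉p ← ∃-available p (ℕ.≤-trans (s≤s (ℕ.m≤m+n ∣ p ∣ m)) h′) =
      find-just _ (∈-allFin j) (z≤n , j∉p)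
    ∷ park-zeros m (occupy s p) (ℕ.≤-trans (ℕ.+-monoˡ-≤ m (∣occupy∣ s p)) h′)
    where s = firstAvailable p zero

  linked-zeros : ∀ m → Linked _≥_ (replicate m (zero {n}))
  linked-zeros zero          = []
  linked-zeros (suc zero)    = [-]
  linked-zeros (suc (suc m)) = z≤n ∷ linked-zeros (suc m)

  ∃-weaklyDecreasingPF : ∀ n → ∃ (IsWeaklyDecreasingPF {n})
  ∃-weaklyDecreasingPF zero    = [] , [] , []
  ∃-weaklyDecreasingPF (suc n) =
    replicate (suc n) zero , linked-zeros (suc n) ,
    park-zeros (suc n) ⊥ (ℕ.≤-reflexive (cong (_+ suc n) (∣⊥∣≡0 (suc n))))

  nonEmpty : ∀ {x : A} {xs} → x ∈ᴸ xs → NonZero (length xs)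
  nonEmpty {xs = _ ∷ _} _ = _

weaklyDecreasingPFs-nonEmpty : ∀ n → NonZero (length (weaklyDecreasingPFs n))
weaklyDecreasingPFs-nonEmpty n with a , pa ← ∃-weaklyDecreasingPF n =
  nonEmpty (weaklyDecreasingPFs-complete a pa)

{-# OPTIONS --safe #-}
-- Counting spots from 0, a weakly decreasing sequence is a parking function iff
-- each preference is at most the number of later cars, and its lucky spots are
-- exactly the preferred ones. Let T m v be the number of possible preferences of
-- the last m cars when these are at most v, and G m v the total number of distinct
-- values other than v in them. Removing the first car gives lattice-path
-- recurrences, solved for v ≤ m by
--   T m v = C(m+v, v) − C(m+v, v−1)  and  G m v = (m+1−v) C(m+v−1, v−1).
-- Spot v = n does not exist, so G n n omits nothing, and
-- 2 G n n = C(2n, n) = (n+1) T n n.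
module Submission where

open import Defs
open import Data.Nat.Base using (ℕ; _≥_; _+_)
open import Data.Integer.Base using (+_)
open import Data.Rational.Base using (½; _*_; _/_)
import Data.Rational.Base as ℚ
open import Relation.Binary.PropositionalEquality using (_≡_)

open import Data.Bool.Base using (Bool; true; false; if_then_else_; _∧_)
open import Data.Fin.Base as Fin using (Fin; zero; suc; toℕ)
import Data.Fin.Properties as Fin
open import Data.Fin.Subset using (Subset; ⊥; ⊤; ∣_∣; _∈_; _∉_; inside; outside)
open import Data.Fin.Subset.Properties using (∉⊥; ∣⊥∣≡0; ∣⊤∣≡n; ⊆⊤; ∈⊤; p⊂q⇒∣p∣<∣q∣; drop-there)
open import Data.Integer.Base as ℤ using ()
import Data.Integer.Properties as ℤ
open import Data.List.Base as List
  using (List; []; _∷_; map; length; filter; find; tabulate; allFin; cartesianProductWith)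
open import Data.List.Membership.Propositional using () renaming (_∈_ to _∈ᴸ_)
open import Data.List.Membership.Propositional.Properties using (∈-allFin)
import Data.List.Properties as List
open import Data.List.Relation.Unary.Any using (here; there)
open import Data.Maybe.Base using (just; nothing)
open import Data.Maybe using (Is-just)
import Data.Maybe.Relation.Unary.Any as MaybeAny
open import Data.Nat.Base as ℕ using (zero; suc; _∸_; _⊓_; _≤_; _<_; z≤n; s≤s; s≤s⁻¹; NonZero)
open import Data.Nat.ListAction using (sum)
open import Data.Nat.ListAction.Properties using (sum-++)
import Data.Nat.Properties as ℕ
open import Data.Nat.Tactic.RingSolver using (solve-∀)
open import Data.Product.Base using (∃; _×_; _,_; proj₁; proj₂)
import Data.Rational.Properties as ℚ
open import Data.Rational.Unnormalised.Base as ℚᵘ using (mkℚᵘ; *≡*)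
import Data.Rational.Unnormalised.Properties as ℚᵘ
open import Data.Sum.Base using (_⊎_; inj₁; inj₂)
open import Data.Unit.Base using (tt) renaming (⊤ to Unit)
open import Data.Vec.Base as Vec using (Vec; []; _∷_; lookup; count; _[_]≔_)
open import Data.Vec.Membership.Propositional using () renaming (_∈_ to _∈ⱽ_)
open import Data.Vec.Membership.Propositional.Properties using (∈-lookup)
open import Data.Vec.Relation.Unary.All using (All; []; _∷_)
import Data.Vec.Relation.Unary.Any as VecAny
open import Data.Vec.Relation.Unary.Linked using (Linked; []; [-]; _∷_)
open import Function.Base using (_∘_; id)
open import Function.Bundles using (_⇔_; mk⇔)
open import Relation.Binary.PropositionalEquality
  using (_≢_; refl; sym; trans; cong; cong₂; subst; module ≡-Reasoning)
open import Relation.Nullary.Decidable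
  using (yes; no; does; _×-dec_; ¬?; dec-true; dec-false; does-⇔)
open import Relation.Nullary.Negation using (¬_; contradiction)
open import Relation.Unary using (Decidable)

private
  variable
    A B C : Set
    k m n : ℕ

-- Sums over initial segments of ℕ

∑< : (ℕ → ℕ) → ℕ → ℕ
∑< f zero    = 0
∑< f (suc k) = ∑< f k + f k

∑<-cong : ∀ {f g : ℕ → ℕ} k → (∀ {x} → x < k → f x ≡ g x) → ∑< f k ≡ ∑< g k
∑<-cong zero    f≗g = refl
∑<-cong (suc k) f≗g = cong₂ _+_ (∑<-cong k (f≗g ∘ ℕ.m<n⇒m<1+n)) (f≗g ℕ.≤-refl)

-- `∑<` grows at its end, `tabulate` at its front; this reconciles the two recursions.
∑<-head : ∀ (f : ℕ → ℕ) k → ∑< f (suc k) ≡ f 0 + ∑< (f ∘ suc) k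
∑<-head f zero    = sym (ℕ.+-identityʳ (f 0))
∑<-head f (suc k) = trans (cong (_+ f (suc k)) (∑<-head f k)) (ℕ.+-assoc (f 0) _ _)

sum-tabulate-zero : ∀ n → sum (tabulate {n = n} (λ _ → 0)) ≡ 0
sum-tabulate-zero zero    = refl
sum-tabulate-zero (suc n) = sum-tabulate-zero n

sum-tabulate-< : ∀ (f : ℕ → ℕ) → k ≤ n →
  sum (tabulate {n = n} (λ x → if does (toℕ x ℕ.<? k) then f (toℕ x) else 0)) ≡ ∑< f k
sum-tabulate-< {n = n} f z≤n = sum-tabulate-zero n
sum-tabulate-< {suc k} f (s≤s k≤n) =
  trans (cong (f 0 ℕ.+_) (sum-tabulate-< (f ∘ suc) k≤n)) (sym (∑<-head f k))

-- Sums over lists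

sum-map-+ : ∀ (f g : A → ℕ) xs →
  sum (map (λ x → f x + g x) xs) ≡ sum (map f xs) + sum (map g xs)
sum-map-+ f g []       = refl
sum-map-+ f g (x ∷ xs) =
  trans (cong (_+_ (f x + g x)) (sum-map-+ f g xs)) (interchange (f x) (g x) _ _)
  where
  interchange : ∀ a b c d → a + b + (c + d) ≡ a + c + (b + d)
  interchange = solve-∀

sum-map-zero : ∀ (xs : List A) → sum (map (λ _ → 0) xs) ≡ 0
sum-map-zero []       = refl
sum-map-zero (_ ∷ xs) = sum-map-zero xs

sum-map-filter : ∀ {P : A → Set} (P? : Decidable P) (f : A → ℕ) xs →
  sum (map f (filter P? xs)) ≡ sum (map (λ x → if does (P? x) then f x else 0) xs)
sum-map-filter P? f []       = refl
sum-map-filter P? f (x ∷ xs) with does (P? x)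
... | true  = cong (f x ℕ.+_) (sum-map-filter P? f xs)
... | false = sum-map-filter P? f xs

length≡sum-map : ∀ (xs : List A) → length xs ≡ sum (map (λ _ → 1) xs)
length≡sum-map []       = refl
length≡sum-map (_ ∷ xs) = cong suc (length≡sum-map xs)

sum-map-cartesianProductWith : ∀ (f : C → ℕ) (g : A → B → C) xs ys →
  sum (map f (cartesianProductWith g xs ys)) ≡ sum (map (λ x → sum (map (f ∘ g x) ys)) xs)
sum-map-cartesianProductWith f g []       ys = refl
sum-map-cartesianProductWith f g (x ∷ xs) ys = begin
  sum (map f (map (g x) ys List.++ zs))            ≡⟨ cong sum (List.map-++ f (map (g x) ys) zs) ⟩
  sum (map f (map (g x) ys) List.++ map f zs)      ≡⟨ sum-++ (map f (map (g x) ys)) (map f zs) ⟩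
  sum (map f (map (g x) ys)) + sum (map f zs)      ≡⟨ cong₂ _+_ (cong sum (sym (List.map-∘ ys)))
                                                        (sum-map-cartesianProductWith f g xs ys) ⟩
  sum (map (f ∘ g x) ys) + sum (map (λ x → sum (map (f ∘ g x) ys)) xs) ∎
  where
  open ≡-Reasoning
  zs = cartesianProductWith g xs ys

-- Lattice paths

-- The binomial coefficient C(a+b, a).
paths : ℕ → ℕ → ℕ
paths zero    b       = 1
paths (suc a) zero    = 1
paths (suc a) (suc b) = paths a (suc b) + paths (suc a) b

-- C(a+b-1, a), read as 0 at b = 0, so that Pascal's rule `paths-sucˡ` also covers the boundary. For
-- a = m+1 it is C(m+b, b-1), the subtracted term of T.
pathsPred : ℕ → ℕ → ℕ
pathsPred a zero    = 0
pathsPred a (suc b) = paths a b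

paths-zeroʳ : ∀ a → paths a 0 ≡ 1
paths-zeroʳ zero    = refl
paths-zeroʳ (suc a) = refl

paths-sucˡ : ∀ a b → paths (suc a) b ≡ paths a b + pathsPred (suc a) b
paths-sucˡ a zero    = sym (cong (_+ 0) (paths-zeroʳ a))
paths-sucˡ a (suc b) = refl

paths-comm : ∀ a b → paths a b ≡ paths b a
paths-comm zero    b       = sym (paths-zeroʳ b)
paths-comm (suc a) zero    = refl
paths-comm (suc a) (suc b) =
  trans (cong₂ _+_ (paths-comm a (suc b)) (paths-comm (suc a) b)) (ℕ.+-comm (paths (suc b) a) _)

-- Both sides equal (a+b+1)! / (a! b!); the induction obtains this from Pascal's rule without
-- factorials.
paths-absorption : ∀ a b → suc a ℕ.* paths (suc a) b ≡ suc b ℕ.* paths a (suc b)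
paths-absorption zero    zero    = refl
paths-absorption zero    (suc b) = cong suc (paths-absorption zero b)
paths-absorption (suc a) zero    = begin
  suc (suc a) ℕ.* 1         ≡⟨ lemma a ⟩
  suc a ℕ.* 1 + 1           ≡⟨ cong (_+ 1) (paths-absorption a zero) ⟩
  1 ℕ.* paths a 1 + 1       ≡⟨ lemma′ (paths a 1) ⟩
  1 ℕ.* (paths a 1 + 1)     ∎
  where
  open ≡-Reasoning
  lemma : ∀ a → suc (suc a) ℕ.* 1 ≡ suc a ℕ.* 1 + 1
  lemma = solve-∀
  lemma′ : ∀ x → 1 ℕ.* x + 1 ≡ 1 ℕ.* (x + 1)
  lemma′ = solve-∀
paths-absorption (suc a) (suc b) = begin
  suc (suc a) ℕ.* (x + paths (suc (suc a)) b)             ≡⟨ ℕ.*-distribˡ-+ (suc (suc a)) x _ ⟩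
  suc (suc a) ℕ.* x + suc (suc a) ℕ.* paths (suc (suc a)) b
    ≡⟨ cong (suc (suc a) ℕ.* x ℕ.+_) (paths-absorption (suc a) b) ⟩
  suc (suc a) ℕ.* x + suc b ℕ.* x                         ≡⟨ lemma a b x ⟩
  suc a ℕ.* x + suc (suc b) ℕ.* x
    ≡⟨ cong (_+ suc (suc b) ℕ.* x) (paths-absorption a (suc b)) ⟩
  suc (suc b) ℕ.* paths a (suc (suc b)) + suc (suc b) ℕ.* x
    ≡⟨ ℕ.*-distribˡ-+ (suc (suc b)) (paths a (suc (suc b))) x ⟨
  suc (suc b) ℕ.* (paths a (suc (suc b)) + x)             ∎
  where
  open ≡-Reasoning
  x = paths (suc a) (suc b)
  lemma : ∀ a b x → suc (suc a) ℕ.* x + suc b ℕ.* x ≡ suc a ℕ.* x + suc (suc b) ℕ.* x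
  lemma = solve-∀

-- The recurrences and their solution

-- This is T: the summation index is the first preference, bounded by v and by the number m of later
-- cars.
ballotNumber : ℕ → ℕ → ℕ
ballotNumber zero    v = 1
ballotNumber (suc m) v = ∑< (ballotNumber m) (suc (v ⊓ m))

-- This is G: a first preference x other than v adds one for each of its `ballotNumber m x`
-- continuations.
totalNewValues : ℕ → ℕ → ℕ
totalNewValues zero    v = 0
totalNewValues (suc m) v = ∑< (λ x →
  if does (x ℕ.≟ v) then totalNewValues m x else ballotNumber m x + totalNewValues m x)
  (suc (v ⊓ m))

-- Hockey-stick summation of both binomials in the closed form of T, with the subtracted one moved
-- to the left to stay in ℕ. The closed form at m is a hypothesis, so the outer induction can be on
-- m.
∑ballotNumber : ∀ m → (∀ {v} → v ≤ m → ballotNumber m v + pathsPred (suc m) v ≡ paths m v) →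
  ∀ {v} → v ≤ m →
  ∑< (ballotNumber m) (suc v) + pathsPred (suc (suc m)) v ≡ paths (suc m) v
∑ballotNumber m hyp {zero}  _ = trans (hyp z≤n) (paths-zeroʳ m)
∑ballotNumber m hyp {suc v} v<m = begin
  s + t + paths (suc (suc m)) v     ≡⟨ cong (s + t ℕ.+_) (paths-sucˡ (suc m) v) ⟩
  s + t + (p + q)                   ≡⟨ lemma s t p q ⟩
  t + p + (s + q)                   ≡⟨ cong₂ _+_ (hyp v<m) (∑ballotNumber m hyp (ℕ.<⇒≤ v<m)) ⟩
  paths m (suc v) + paths (suc m) v ∎
  where
  open ≡-Reasoning
  s = ∑< (ballotNumber m) (suc v)
  t = ballotNumber m (suc v)
  p = paths (suc m) v
  q = pathsPred (suc (suc m)) v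
  lemma : ∀ s t p q → s + t + (p + q) ≡ t + p + (s + q)
  lemma = solve-∀

ballotNumber-closed : ∀ m {v} → v ≤ m → ballotNumber m v + pathsPred (suc m) v ≡ paths m v
ballotNumber-closed zero    z≤n = refl
ballotNumber-closed (suc m) {v} v≤1+m with ℕ.m≤n⇒m<n∨m≡n v≤1+m
... | inj₁ (s≤s v≤m) rewrite ℕ.m≤n⇒m⊓n≡m v≤m = ∑ballotNumber m (ballotNumber-closed m) v≤m
-- The sum stops at m instead of m+1, which is harmless: the formula for the missing term gives
-- C(2m+1, m+1) - C(2m+1, m) = 0. This is the symmetry of `paths` used below.
... | inj₂ refl rewrite ℕ.m≥n⇒m⊓n≡n (ℕ.n≤1+n m) = begin
  s + paths (suc (suc m)) m         ≡⟨ cong (s ℕ.+_) (paths-sucˡ (suc m) m) ⟩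
  s + (p + q)                       ≡⟨ lemma s p q ⟩
  p + (s + q)                       ≡⟨ cong₂ _+_ (paths-comm (suc m) m)
                                         (∑ballotNumber m (ballotNumber-closed m) ℕ.≤-refl) ⟩
  paths m (suc m) + paths (suc m) m ∎
  where
  open ≡-Reasoning
  s = ∑< (ballotNumber m) (suc m)
  p = paths (suc m) m
  q = pathsPred (suc (suc m)) m
  lemma : ∀ s p q → s + (p + q) ≡ p + (s + q)
  lemma = solve-∀

-- Each summand counts distinct values, first entry included, over the sequences of length m+1 that
-- start with x.
totalValues : ℕ → ℕ → ℕ
totalValues m = ∑< (λ x → ballotNumber m x + totalNewValues m x)

if-≡ : ∀ {a b : A} v → (if does (v ℕ.≟ v) then a else b) ≡ a
if-≡ v rewrite dec-true (v ℕ.≟ v) refl = refl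

if-≢ : ∀ {x v} {a b : A} → x ≢ v → (if does (x ℕ.≟ v) then a else b) ≡ b
if-≢ {x = x} {v} x≢v rewrite dec-false (x ℕ.≟ v) x≢v = refl

totalNewValues-low : ∀ {m v} → v ≤ m →
  totalNewValues (suc m) v ≡ totalValues m v + totalNewValues m v
totalNewValues-low {m} {v} v≤m rewrite ℕ.m≤n⇒m⊓n≡m v≤m =
  cong₂ _+_ (∑<-cong v (if-≢ ∘ ℕ.<⇒≢)) (if-≡ v)

-- The first preference is capped at m, so it never equals m+1 and no summand drops its own first
-- entry.
totalNewValues-top : ∀ m → totalNewValues (suc m) (suc m) ≡ totalValues m (suc m)
totalNewValues-top m rewrite ℕ.m≥n⇒m⊓n≡n (ℕ.n≤1+n m) = ∑<-cong (suc m) (if-≢ ∘ ℕ.<⇒≢)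

totalNewValues-zero : ∀ m → totalNewValues m 0 ≡ 0
totalNewValues-zero zero    = refl
totalNewValues-zero (suc m) = totalNewValues-zero m

suc-∸-suc : ∀ {m v} → v < m → m ∸ v ≡ suc (m ∸ suc v)
suc-∸-suc {m} v<m = ℕ.+-∸-assoc 1 v<m

-- The term added on the left is G m (v+1) if v < m and 0 if v = m, so the left side is G (m+1)
-- (v+1) in both cases. Induction on v then needs only the closed forms at m.
totalValues-closed : ∀ m →
  (∀ {v} → v < m → totalNewValues m (suc v) ≡ (m ∸ v) ℕ.* paths m v) →
  ∀ {v} → v ≤ m →
  totalValues m (suc v) + (m ∸ v) ℕ.* paths m v ≡ suc (m ∸ v) ℕ.* paths (suc m) v
totalValues-closed m hyp {zero} _
  rewrite totalNewValues-zero m | paths-zeroʳ m =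
    cong (λ t → t + 0 + m ℕ.* 1) b≡1
  where
  b≡1 : ballotNumber m 0 ≡ 1
  b≡1 = trans (sym (ℕ.+-identityʳ _)) (trans (ballotNumber-closed m z≤n) (paths-zeroʳ m))
totalValues-closed m hyp {suc v} v<m = begin
  s + (t + g) + d ℕ.* p                             ≡⟨ cong (λ g → s + (t + g) + d ℕ.* p) g≡ ⟩
  s + (t + suc d ℕ.* q) + d ℕ.* p                   ≡⟨ lemma s t (suc d ℕ.* q) (d ℕ.* p) ⟩
  (s + suc d ℕ.* q) + (t + d ℕ.* p)                 ≡⟨ cong (_+ (t + d ℕ.* p)) ih ⟩
  -- One copy of r is split off: t + r is the left side of `ballotNumber-closed`.
  suc (suc d) ℕ.* r + (t + d ℕ.* p)                 ≡⟨ lemma′ d r t p ⟩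
  suc d ℕ.* r + (t + r) + d ℕ.* p                   ≡⟨ cong (λ x → suc d ℕ.* r + x + d ℕ.* p)
                                                          (ballotNumber-closed m v<m) ⟩
  suc d ℕ.* r + p + d ℕ.* p                         ≡⟨ lemma″ d r p ⟩
  suc d ℕ.* (p + r)                                 ∎
  where
  open ≡-Reasoning
  s = totalValues m (suc v)
  t = ballotNumber m (suc v)
  g = totalNewValues m (suc v)
  d = m ∸ suc v
  p = paths m (suc v)
  q = paths m v
  r = paths (suc m) v
  g≡ : g ≡ suc d ℕ.* q
  g≡ = trans (hyp v<m) (cong (ℕ._* q) (suc-∸-suc v<m))
  ih : s + suc d ℕ.* q ≡ suc (suc d) ℕ.* r
  ih = subst (λ e → s + e ℕ.* q ≡ suc e ℕ.* r) (suc-∸-suc v<m)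
         (totalValues-closed m hyp (ℕ.<⇒≤ v<m))
  lemma : ∀ s t x y → s + (t + x) + y ≡ (s + x) + (t + y)
  lemma = solve-∀
  lemma′ : ∀ d r t p → suc (suc d) ℕ.* r + (t + d ℕ.* p) ≡ suc d ℕ.* r + (t + r) + d ℕ.* p
  lemma′ = solve-∀
  lemma″ : ∀ d r p → suc d ℕ.* r + p + d ℕ.* p ≡ suc d ℕ.* (p + r)
  lemma″ = solve-∀

totalNewValues-closed : ∀ m {v} → v < m → totalNewValues m (suc v) ≡ (m ∸ v) ℕ.* paths m v
totalNewValues-closed (suc m) {v} (s≤s v≤m) = begin
  totalNewValues (suc m) (suc v)                ≡⟨ split (ℕ.m≤n⇒m<n∨m≡n v≤m) ⟩
  totalValues m (suc v) + (m ∸ v) ℕ.* paths m v ≡⟨ totalValues-closed m (totalNewValues-closed m) v≤m ⟩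
  suc (m ∸ v) ℕ.* paths (suc m) v               ≡⟨ cong (ℕ._* paths (suc m) v) (suc-∸-suc (s≤s v≤m)) ⟨
  (suc m ∸ v) ℕ.* paths (suc m) v               ∎
  where
  open ≡-Reasoning
  split : v < m ⊎ v ≡ m →
    totalNewValues (suc m) (suc v) ≡ totalValues m (suc v) + (m ∸ v) ℕ.* paths m v
  split (inj₁ v<m)  = trans (totalNewValues-low v<m)
    (cong (totalValues m (suc v) ℕ.+_) (totalNewValues-closed m v<m))
  split (inj₂ refl) = trans (totalNewValues-top m)
    (sym (trans (cong (λ d → totalValues m (suc m) + d ℕ.* paths m m) (ℕ.n∸n≡0 m))
                (ℕ.+-identityʳ _)))

2*totalNewValues : ∀ n → n ≥ 1 → 2 ℕ.* totalNewValues n n ≡ suc n ℕ.* ballotNumber n n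
2*totalNewValues n@(suc m) _ = begin
  2 ℕ.* totalNewValues n n          ≡⟨ cong (2 ℕ.*_) (totalNewValues-closed n ℕ.≤-refl) ⟩
  2 ℕ.* ((n ∸ m) ℕ.* paths n m)     ≡⟨ cong (λ d → 2 ℕ.* (d ℕ.* paths n m)) (ℕ.m+n∸n≡m 1 m) ⟩
  2 ℕ.* (1 ℕ.* paths n m)           ≡⟨ lemma (paths n m) ⟩
  -- By symmetry the two copies become the two summands of Pascal's rule for `paths n n`.
  paths n m + paths n m             ≡⟨ cong (_+ paths n m) (paths-comm n m) ⟩
  paths n n                         ≡⟨ ℕ.+-cancelʳ-≡ (n ℕ.* paths n n) _ _ cancel ⟨
  suc n ℕ.* ballotNumber n n        ∎
  where
  open ≡-Reasoning
  lemma : ∀ x → 2 ℕ.* (1 ℕ.* x) ≡ x + x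
  lemma = solve-∀
  -- Adding n C(2n, n) = (n+1) C(2n, n-1) to both sides turns the Catalan identity into a multiple
  -- of the closed form of T n n.
  cancel : suc n ℕ.* ballotNumber n n + n ℕ.* paths n n ≡ paths n n + n ℕ.* paths n n
  cancel = begin
    suc n ℕ.* ballotNumber n n + n ℕ.* paths n n
      ≡⟨ cong (suc n ℕ.* ballotNumber n n ℕ.+_) (paths-absorption n m) ⟨
    suc n ℕ.* ballotNumber n n + suc n ℕ.* paths (suc n) m
      ≡⟨ ℕ.*-distribˡ-+ (suc n) (ballotNumber n n) _ ⟨
    suc n ℕ.* (ballotNumber n n + paths (suc n) m)
      ≡⟨ cong (suc n ℕ.*_) (ballotNumber-closed n ℕ.≤-refl) ⟩
    suc n ℕ.* paths n n ∎

-- Ballot sequences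

-- One bound per entry combines weak decrease (by the preceding entry, or v at the start) with the
-- parking criterion (by the number of later entries). It is written as a strict bound to match the
-- range of `∑<` in the recurrences.
Ballot : ℕ → Vec (Fin n) m → Set
Ballot             v []      = Unit
Ballot {m = suc m} v (x ∷ w) = toℕ x < suc (v ⊓ m) × Ballot (toℕ x) w

ballot? : ∀ v → Decidable (Ballot {n} {m} v)
ballot?             v []      = yes tt
ballot? {m = suc m} v (x ∷ w) = (toℕ x ℕ.<? suc (v ⊓ m)) ×-dec ballot? (toℕ x) w

-- Comparing each entry only with its predecessor counts distinct values correctly on ballot
-- sequences, where equal entries are adjacent.
newValues : ℕ → Vec (Fin n) m → ℕ
newValues v []      = 0
newValues v (x ∷ w) =
  if does (toℕ x ℕ.≟ v) then newValues (toℕ x) w else suc (newValues (toℕ x) w)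

-- An indicator over all vectors, rather than a filtered list, keeps the product structure from
-- which the first entry can be summed out.
sumBallot : ∀ n m → ℕ → (Vec (Fin n) m → ℕ) → ℕ
sumBallot n m v f =
  sum (map (λ w → if does (ballot? v w) then f w else 0) (vectors (allFin n) m))

sumBallot-+ : ∀ {v} (f g : Vec (Fin n) m → ℕ) →
  sumBallot n m v (λ w → f w + g w) ≡ sumBallot n m v f + sumBallot n m v g
sumBallot-+ {n} {m} {v} f g = trans
  (cong sum (List.map-cong (λ w → if-+ (does (ballot? v w))) (vectors (allFin n) m)))
  (sum-map-+ _ _ (vectors (allFin n) m))
  where
  if-+ : ∀ b {x y} → (if b then x + y else 0) ≡ (if b then x else 0) + (if b then y else 0)
  if-+ true  = refl
  if-+ false = refl

sumBallot-suc : ∀ {v} (f : Vec (Fin n) (suc m) → ℕ) (F : ℕ → ℕ) → suc m ≤ n →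
  (∀ x → sumBallot n m (toℕ x) (λ w → f (x ∷ w)) ≡ F (toℕ x)) →
  sumBallot n (suc m) v f ≡ ∑< F (suc (v ⊓ m))
sumBallot-suc {n} {m} {v} f F m<n hyp = begin
  sumBallot n (suc m) v f
    ≡⟨ sum-map-cartesianProductWith _ _∷_ (allFin n) (vectors (allFin n) m) ⟩
  sum (map (λ x → sum (map (λ w → if c x ∧ does (ballot? (toℕ x) w) then f (x ∷ w) else 0)
                        (vectors (allFin n) m))) (allFin n))
    -- The decision for `x ∷ w` is a conjunction whose first part does not involve w, so it leaves
    -- the inner sum.
    ≡⟨ cong sum (List.map-cong (λ x → pull x (c x)) (allFin n)) ⟩
  sum (map (λ x → if c x then F (toℕ x) else 0) (allFin n))
    ≡⟨ cong sum (List.map-tabulate id (λ x → if c x then F (toℕ x) else 0)) ⟩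
  sum (tabulate (λ x → if c x then F (toℕ x) else 0))
    -- Since `v ⊓ m` is at most m < n, every index of the `∑<` is the value of an element of
    -- `Fin n`.
    ≡⟨ sum-tabulate-< F (ℕ.≤-trans (s≤s (ℕ.m⊓n≤n v m)) m<n) ⟩
  ∑< F (suc (v ⊓ m)) ∎
  where
  open ≡-Reasoning
  c : Fin n → Bool
  c x = does (toℕ x ℕ.<? suc (v ⊓ m))
  pull : ∀ x b →
    sum (map (λ w → if b ∧ does (ballot? (toℕ x) w) then f (x ∷ w) else 0)
      (vectors (allFin n) m)) ≡ (if b then F (toℕ x) else 0)
  pull x true  = hyp x
  pull x false = sum-map-zero (vectors (allFin n) m)

sumBallot-one : ∀ m v → m ≤ n → sumBallot n m v (λ _ → 1) ≡ ballotNumber m v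
sumBallot-one zero    v _   = refl
sumBallot-one (suc m) v m<n = sumBallot-suc _ (ballotNumber m) m<n
  (λ x → sumBallot-one m (toℕ x) (ℕ.<⇒≤ m<n))

sumBallot-newValues : ∀ m v → m ≤ n → sumBallot n m v (newValues v) ≡ totalNewValues m v
sumBallot-newValues     zero    v _   = refl
sumBallot-newValues {n} (suc m) v m<n = sumBallot-suc _ _ m<n step
  where
  step : ∀ x → sumBallot n m (toℕ x) (λ w → newValues v (x ∷ w)) ≡
    (if does (toℕ x ℕ.≟ v) then totalNewValues m (toℕ x)
      else ballotNumber m (toℕ x) + totalNewValues m (toℕ x))
  step x with does (toℕ x ℕ.≟ v)
  ... | true  = sumBallot-newValues m (toℕ x) (ℕ.<⇒≤ m<n)
  -- The new first entry contributes 1 for every ballot continuation, whence the summand T m x.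
  ... | false = trans (sumBallot-+ {n} {m} {toℕ x} (λ _ → 1) (newValues (toℕ x)))
    (cong₂ _+_ (sumBallot-one m (toℕ x) (ℕ.<⇒≤ m<n)) (sumBallot-newValues m (toℕ x) (ℕ.<⇒≤ m<n)))

head≤ : ∀ v {x : Fin n} {w : Vec (Fin n) m} → Ballot v (x ∷ w) → toℕ x ≤ v
head≤ {m = m} v (x< , _) = ℕ.≤-trans (s≤s⁻¹ x<) (ℕ.m⊓n≤m v m)

ballot⇒∈≤ : ∀ v (w : Vec (Fin n) m) → Ballot v w → ∀ {j} → j ∈ⱽ w → toℕ j ≤ v
ballot⇒∈≤ v (x ∷ w) b       (VecAny.here refl) = head≤ v b
ballot⇒∈≤ v (x ∷ w) b@(_ , b′) (VecAny.there j∈w) =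
  ℕ.≤-trans (ballot⇒∈≤ (toℕ x) w b′ j∈w) (head≤ v b)

ballot⇒weaklyDecreasing : ∀ v (w : Vec (Fin n) m) → Ballot v w → Linked Fin._≥_ w
ballot⇒weaklyDecreasing v []          _       = []
ballot⇒weaklyDecreasing v (x ∷ [])    _       = [-]
ballot⇒weaklyDecreasing v (x ∷ y ∷ w) (_ , b) =
  head≤ (toℕ x) b ∷ ballot⇒weaklyDecreasing (toℕ x) (y ∷ w) b

-- Parking

find-just : ∀ {P : A → Set} (P? : Decidable P) xs {x} → find P? xs ≡ just x → P x
find-just P? (y ∷ ys) eq with P? y
find-just P? (y ∷ ys) refl | yes py = py
find-just P? (y ∷ ys) eq   | no _   = find-just P? ys eq

find-complete : ∀ {P : A → Set} (P? : Decidable P) {x xs} → x ∈ᴸ xs → P x → Is-just (find P? xs)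
find-complete P? {xs = y ∷ _} x∈ px with P? y
find-complete P? _           px | yes _  = MaybeAny.just tt
find-complete P? (here refl) px | no ¬py = contradiction px ¬py
find-complete P? (there x∈)  px | no _   = find-complete P? x∈ px

find-tabulate : ∀ {P : A → Set} (P? : Decidable P) (f : Fin n → A) i → P (f i) →
  (∀ {j} → j Fin.< i → ¬ P (f j)) → find P? (tabulate f) ≡ just (f i)
find-tabulate P? f zero    pi below with P? (f zero)
... | yes _  = refl
... | no ¬pi = contradiction pi ¬pi
find-tabulate P? f (suc i) pi below with P? (f zero)
... | yes p0 = contradiction p0 (below (s≤s z≤n))
... | no _   = find-tabulate P? (f ∘ suc) i pi (below ∘ s≤s)

Available : Subset n → Fin n → Fin n → Set
Available p x j = x Fin.≤ j × j ∉ p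

firstAvailable-just : ∀ {p : Subset n} {x j} → firstAvailable p x ≡ just j → Available p x j
firstAvailable-just {n} = find-just _ (allFin n)

firstAvailable-own : ∀ {p : Subset n} {x} → x ∉ p → firstAvailable p x ≡ just x
firstAvailable-own {x = x} x∉p =
  find-tabulate _ id x (ℕ.≤-refl , x∉p) λ j<x (x≤j , _) → ℕ.<⇒≱ j<x x≤j

∈-insert⁻ : ∀ (p : Subset n) j {k} → k ∈ p [ j ]≔ inside → k ≡ j ⊎ k ∈ p
∈-insert⁻ (s ∷ p) zero    {zero}  _  = inj₁ refl
∈-insert⁻ (s ∷ p) zero    {suc k} (Vec.there k∈) = inj₂ (Vec.there k∈)
∈-insert⁻ (s ∷ p) (suc j) {zero}  Vec.here = inj₂ Vec.here
∈-insert⁻ (s ∷ p) (suc j) {suc k} (Vec.there k∈) with ∈-insert⁻ p j k∈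
... | inj₁ refl = inj₁ refl
... | inj₂ k∈p  = inj₂ (Vec.there k∈p)

∣insert∣ : ∀ (p : Subset n) {j} → j ∉ p → ∣ p [ j ]≔ inside ∣ ≡ suc ∣ p ∣
∣insert∣ (outside ∷ p) {zero}  j∉p = refl
∣insert∣ (inside  ∷ p) {zero}  j∉p = contradiction Vec.here j∉p
∣insert∣ (outside ∷ p) {suc j} j∉p = ∣insert∣ p (j∉p ∘ Vec.there)
∣insert∣ (inside  ∷ p) {suc j} j∉p = cong suc (∣insert∣ p (j∉p ∘ Vec.there))

-- Pigeonhole: fewer than n - x occupied spots cannot fill the n - x spots from x on.
∃-available : ∀ (p : Subset n) x → ∣ p ∣ + x < n → ∃ λ j → x ≤ toℕ j × j ∉ p
∃-available (outside ∷ p) zero h       = zero , z≤n , λ ()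
∃-available (inside  ∷ p) zero (s≤s h) with j , _ , j∉p ← ∃-available p zero h =
  suc j , z≤n , j∉p ∘ drop-there
∃-available {suc n} (outside ∷ p) (suc x) h
  with j , x≤j , j∉p ← ∃-available p x (s≤s⁻¹ (subst (_< suc n) (ℕ.+-suc ∣ p ∣ x) h)) =
  suc j , s≤s x≤j , j∉p ∘ drop-there
∃-available (inside ∷ p) (suc x) (s≤s h)
  with j , x≤j , j∉p ← ∃-available p x (ℕ.<-trans (ℕ.+-monoʳ-< ∣ p ∣ (ℕ.n<1+n x)) h) =
  suc j , s≤s x≤j , j∉p ∘ drop-there

firstAvailable-complete : ∀ (p : Subset n) x → ∣ p ∣ + toℕ x < n → Is-just (firstAvailable p x)
firstAvailable-complete p x room with j , x≤j , j∉p ← ∃-available p (toℕ x) room =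
  find-complete _ (∈-allFin j) (x≤j , j∉p)

-- The x spots before x, the occupied spots and the free spot j are pairwise distinct, so together
-- they number at most n.
available⇒< : ∀ (p : Subset n) x {j} → (∀ {k} → k ∈ p → x ≤ toℕ k) →
  x ≤ toℕ j → j ∉ p → ∣ p ∣ + x < n
available⇒< {n} p zero {j} _ _ j∉p
  rewrite ℕ.+-identityʳ ∣ p ∣ =
    subst (∣ p ∣ <_) (∣⊤∣≡n n) (p⊂q⇒∣p∣<∣q∣ (⊆⊤ , j , ∈⊤ , j∉p))
available⇒< (inside  ∷ p) (suc x) p≥ _ _ = contradiction (p≥ Vec.here) λ ()
available⇒< {suc n} (outside ∷ p) (suc x) {suc j} p≥ (s≤s x≤j) j∉p =
  subst (_< suc n) (sym (ℕ.+-suc ∣ p ∣ x))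
    (s≤s (available⇒< p x (s≤s⁻¹ ∘ p≥ ∘ Vec.there) x≤j (j∉p ∘ Vec.there)))

insert-≥ : ∀ (p : Subset n) {x : ℕ} {j} → (∀ {k} → k ∈ p → x ≤ toℕ k) → x ≤ toℕ j →
  ∀ {k} → k ∈ p [ j ]≔ inside → x ≤ toℕ k
insert-≥ p {j = j} p≥ x≤j k∈ with ∈-insert⁻ p j k∈
... | inj₁ refl = x≤j
... | inj₂ k∈p  = p≥ k∈p

∣insert∣+ : ∀ (p : Subset n) {j} → j ∉ p → ∣ p ∣ + suc m ≡ n → ∣ p [ j ]≔ inside ∣ + m ≡ n
∣insert∣+ {m = m} p j∉p eq = trans (cong (_+ m) (∣insert∣ p j∉p)) (trans (sym (ℕ.+-suc ∣ p ∣ m)) eq)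

-- While every car has parked, occupied spots and remaining cars total n. As x is less than the
-- number of remaining cars, ∣p∣ + x < n, which leaves a free spot from x on.
ballot⇒parks : ∀ v (p : Subset n) (w : Vec (Fin n) m) → ∣ p ∣ + m ≡ n →
  Ballot v w → All Is-just (park p w)
ballot⇒parks v p [] _ _ = []
ballot⇒parks {n} {suc m} v p (x ∷ w) eq (x< , b)
  with firstAvailable p x in fa
     | firstAvailable-complete p x (subst (∣ p ∣ + toℕ x <_) eq
         (ℕ.+-monoʳ-< ∣ p ∣ (ℕ.≤-trans x< (s≤s (ℕ.m⊓n≤n v m)))))
... | just j | ij =
  ij ∷ ballot⇒parks (toℕ x) (p [ j ]≔ inside) w
         (∣insert∣+ p (proj₂ (firstAvailable-just {p = p} {x} fa)) eq) b

-- Preferences decrease, so all occupied spots lie at or beyond x. The x spots before x and the spot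
-- j now taken are thus among the m+1 free ones, whence x ≤ m.
parks⇒ballot : ∀ v (p : Subset n) x (w : Vec (Fin n) m) → (∀ {k} → k ∈ p → x Fin.≤ k) →
  ∣ p ∣ + suc m ≡ n → toℕ x ≤ v → Linked Fin._≥_ (x ∷ w) →
  All Is-just (park p (x ∷ w)) → Ballot v (x ∷ w)
parks⇒ballot {n} {m} v p x w p≥x eq x≤v l pf with firstAvailable p x in fa
parks⇒ballot {n} {m} v p x w p≥x eq x≤v l (ij ∷ pf) | just j =
  s≤s (ℕ.⊓-glb x≤v x≤m) , rest w l pf
  where
  x≤j : x Fin.≤ j
  x≤j = proj₁ (firstAvailable-just {p = p} {x} fa)
  j∉p : j ∉ p
  j∉p = proj₂ (firstAvailable-just {p = p} {x} fa)
  x≤m : toℕ x ≤ m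
  x≤m = s≤s⁻¹ (ℕ.+-cancelˡ-< ∣ p ∣ (toℕ x) (suc m)
    (subst (∣ p ∣ + toℕ x <_) (sym eq) (available⇒< p (toℕ x) p≥x x≤j j∉p)))
  rest : ∀ w → Linked Fin._≥_ (x ∷ w) → All Is-just (park (p [ j ]≔ inside) w) → Ballot (toℕ x) w
  rest []      _         _  = tt
  rest (y ∷ w) (y≤x ∷ l) pf = parks⇒ballot (toℕ x) (p [ j ]≔ inside) y w
    -- The invariant passes to y, because j and the spots occupied before are all at least x, and y
    -- is at most x.
    (λ k∈ → ℕ.≤-trans y≤x (insert-≥ p p≥x x≤j k∈)) (∣insert∣+ p j∉p eq) y≤x l pf

-- The starting bound n exceeds every spot, so the first preference is limited only by the number of
-- later cars.
isWeaklyDecreasingPF⇔ballot : ∀ (a : Preferences n) → IsWeaklyDecreasingPF a ⇔ Ballot n a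
isWeaklyDecreasingPF⇔ballot {n} a = mk⇔ (to a (cong (_+ n) (∣⊥∣≡0 n)))
  λ b → ballot⇒weaklyDecreasing n a b , ballot⇒parks n ⊥ a (cong (_+ n) (∣⊥∣≡0 n)) b
  where
  -- The length m is separated from n, so that matching on the vector leaves the street unchanged.
  to : ∀ (a : Vec (Fin n) m) → ∣ ⊥ {n} ∣ + m ≡ n →
    Linked Fin._≥_ a × All Is-just (park ⊥ a) → Ballot n a
  to []      _  _        = tt
  to (x ∷ w) eq (l , pf) = parks⇒ballot n ⊥ x w (λ k∈ → contradiction k∈ ∉⊥) eq
    (ℕ.<⇒≤ (Fin.toℕ<n x)) l pf

-- Lucky spots

-- All earlier cars prefer, hence take, spots beyond j, so the first car that
-- prefers j finds it free.
∈⇒lucky : ∀ v (p : Subset n) (w : Vec (Fin n) m) → Ballot v w → ∀ {j} → j ∉ p → j ∈ⱽ w →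
  ∃ λ i → lookup (park p w) i ≡ just j × lookup w i ≡ j
∈⇒lucky v p (x ∷ w) (_ , b) {j} j∉p j∈ with x Fin.≟ j | j∈
... | yes refl | _                  = zero , firstAvailable-own j∉p , refl
... | no x≢j   | VecAny.here refl   = contradiction refl x≢j
... | no x≢j   | VecAny.there j∈w  =
  let i , parked , prefers = ∈⇒lucky (toℕ x) _ w b (unoccupied (firstAvailable p x) refl) j∈w
  in suc i , parked , prefers
  where
  j<x : j Fin.< x
  j<x = ℕ.≤∧≢⇒< (ballot⇒∈≤ (toℕ x) w b j∈w) (x≢j ∘ sym ∘ Fin.toℕ-injective)
  unoccupied : ∀ s → firstAvailable p x ≡ s → j ∉ occupy s p
  unoccupied nothing  _  = j∉p
  unoccupied (just k) fa j∈ with ∈-insert⁻ p k j∈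
  ... | inj₁ refl = ℕ.<⇒≱ j<x (proj₁ (firstAvailable-just {p = p} {x} fa))
  ... | inj₂ j∈p  = j∉p j∈p

-- Counting distinct preferences

count-cong : ∀ {P Q : A → Set} (P? : Decidable P) (Q? : Decidable Q) → (∀ x → P x ⇔ Q x) →
  ∀ (xs : Vec A m) → count P? xs ≡ count Q? xs
count-cong P? Q? P⇔Q []       = refl
count-cong P? Q? P⇔Q (x ∷ xs)
  rewrite does-⇔ (P⇔Q x) (P? x) (Q? x) | count-cong P? Q? P⇔Q xs = refl

-- Serves the case of a first entry x other than v in `count-new`: x is new relative to v but not to
-- itself, and no other value changes status.
count-tabulate-suc : ∀ {P Q : A → Set} (P? : Decidable P) (Q? : Decidable Q) (f : Fin m → A) i →
  P (f i) → ¬ Q (f i) → (∀ {j} → j ≢ i → P (f j) ⇔ Q (f j)) →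
  count P? (Vec.tabulate f) ≡ suc (count Q? (Vec.tabulate f))
count-tabulate-suc {m = suc m} {P = P} {Q} P? Q? f zero p ¬q P⇔Q
  rewrite dec-true (P? (f zero)) p | dec-false (Q? (f zero)) ¬q =
    cong suc (go (f ∘ suc) (λ j → P⇔Q λ ()))
  where
  go : ∀ {m} (g : Fin m → _) → (∀ j → P (g j) ⇔ Q (g j)) →
    count P? (Vec.tabulate g) ≡ count Q? (Vec.tabulate g)
  go {zero}  g e = refl
  go {suc m} g e rewrite does-⇔ (e zero) (P? _) (Q? _) | go (g ∘ suc) (e ∘ suc) = refl
count-tabulate-suc P? Q? f (suc i) p ¬q P⇔Q
  rewrite does-⇔ (P⇔Q {zero} λ ()) (P? _) (Q? _)
        | count-tabulate-suc P? Q? (f ∘ suc) i p ¬q (λ j≢i → P⇔Q (j≢i ∘ Fin.suc-injective))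
  with does (Q? (f zero))
... | true  = refl
... | false = refl

New : ℕ → Vec (Fin n) m → Fin n → Set
New v w j = j ∈ⱽ w × toℕ j ≢ v

new? : ∀ v (w : Vec (Fin n) m) → Decidable (New v w)
new? v w j = VecAny.any? (j Fin.≟_) w ×-dec ¬? (toℕ j ℕ.≟ v)

-- If x = v, dropping x loses no value other than v. If x < v, then x is counted once, and the later
-- values other than x are all new because they stay below v.
count-new : ∀ v (w : Vec (Fin n) m) → Ballot v w → count (new? v w) (Vec.allFin n) ≡ newValues v w
count-new {n} v [] _ = count-none n id
  where
  count-none : ∀ k (f : Fin k → Fin n) → count (new? v []) (Vec.tabulate f) ≡ 0
  count-none zero    f = refl
  count-none (suc k) f = count-none k (f ∘ suc)
count-new {n} v (x ∷ w) b@(_ , b′) with toℕ x ℕ.≟ v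
... | yes refl = trans
  (count-cong (new? v (x ∷ w)) (new? v w) (λ j → mk⇔ to λ (j∈ , j≢) → VecAny.there j∈ , j≢) (Vec.allFin n))
  (trans (count-new (toℕ x) w b′) (sym (if-≡ v)))
  where
  to : ∀ {j} → New v (x ∷ w) j → New v w j
  to (VecAny.here refl , j≢) = contradiction refl j≢
  to (VecAny.there j∈  , j≢) = j∈ , j≢
... | no x≢v = trans
  (count-tabulate-suc (new? v (x ∷ w)) (new? (toℕ x) w) id x (VecAny.here refl , x≢v)
    (λ (_ , x≢x) → x≢x refl) (λ j≢x → mk⇔ (to j≢x) from))
  (trans (cong suc (count-new (toℕ x) w b′)) (sym (if-≢ x≢v)))
  where
  to : ∀ {j} → j ≢ x → New v (x ∷ w) j → New (toℕ x) w j
  to j≢x (VecAny.here refl , _) = contradiction refl j≢x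
  to j≢x (VecAny.there j∈  , _) = j∈ , j≢x ∘ Fin.toℕ-injective
  from : ∀ {j} → New (toℕ x) w j → New v (x ∷ w) j
  from (j∈ , _) = VecAny.there j∈ ,
    ℕ.<⇒≢ (ℕ.≤-<-trans (ballot⇒∈≤ (toℕ x) w b′ j∈) (ℕ.≤∧≢⇒< (head≤ v b) x≢v))

-- A lucky spot is preferred by definition, and a preferred spot is lucky by `∈⇒lucky` on the empty
-- street. No spot has index n, so taking v = n omits nothing.
numLucky≡newValues : ∀ (a : Preferences n) → Ballot n a → numLucky a ≡ newValues n a
numLucky≡newValues {n} a b = trans
  (count-cong (lucky? a) (new? n a) (λ j → mk⇔ to λ (j∈ , _) → ∈⇒lucky n ⊥ a b ∉⊥ j∈) (Vec.allFin n))
  (count-new n a b)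
  where
  to : ∀ {j} → Lucky a j → New n a j
  to (i , _ , refl) = ∈-lookup i a , ℕ.<⇒≢ (Fin.toℕ<n _)

-- From sums over parking functions to the expectation

sum-map-weaklyDecreasingPFs : ∀ (f g : Preferences n → ℕ) → (∀ a → Ballot n a → f a ≡ g a) →
  sum (map f (weaklyDecreasingPFs n)) ≡ sumBallot n n n g
sum-map-weaklyDecreasingPFs {n} f g f≗g = trans
  (sum-map-filter isWeaklyDecreasingPF? f (vectors (allFin n) n))
  (cong sum (List.map-cong step (vectors (allFin n) n)))
  where
  step : ∀ a → (if does (isWeaklyDecreasingPF? a) then f a else 0) ≡
               (if does (ballot? n a) then g a else 0)
  step a rewrite does-⇔ (isWeaklyDecreasingPF⇔ballot a) (isWeaklyDecreasingPF? a) (ballot? n a)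
    with ballot? n a
  ... | yes b = f≗g a b
  ... | no _  = refl

-- The quotient `/` reduces to lowest terms, so the comparison is made among unnormalised fractions,
-- where equality is cross-multiplication.
/≡½* : ∀ s l k .{{_ : NonZero l}} → 2 ℕ.* s ≡ k ℕ.* l → + s / l ≡ ½ * (+ k / 1)
/≡½* s (suc l) k eq = ℚ.toℚᵘ-injective (begin
  ℚ.toℚᵘ (+ s / suc l)            ≈⟨ ℚ.toℚᵘ-fromℚᵘ (mkℚᵘ (+ s) l) ⟩
  mkℚᵘ (+ s) l                    ≈⟨ *≡* cross ⟩
  ℚᵘ.½ ℚᵘ.* mkℚᵘ (+ k) 0          ≈⟨ ℚᵘ.*-congˡ {ℚᵘ.½} (ℚ.toℚᵘ-fromℚᵘ (mkℚᵘ (+ k) 0)) ⟨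
  ℚᵘ.½ ℚᵘ.* ℚ.toℚᵘ (+ k / 1)      ≈⟨ ℚ.toℚᵘ-homo-* ½ (+ k / 1) ⟨
  ℚ.toℚᵘ (½ * (+ k / 1))          ∎)
  where
  open ℚᵘ.≃-Reasoning
  cross : + s ℤ.* + 2 ≡ (+ 1 ℤ.* + k) ℤ.* + suc l
  cross = trans (sym (ℤ.pos-* s 2)) (trans (cong (λ i → + i) (trans (ℕ.*-comm s 2) eq))
    (trans (ℤ.pos-* k (suc l)) (cong (ℤ._* + suc l) (sym (ℤ.*-identityˡ (+ k))))))

theorem4p2 : (n : ℕ) → n ≥ 1 →
    𝔼 numLucky (weaklyDecreasingPFs n) {{weaklyDecreasingPFs-nonEmpty n}} ≡ ½ * (+ (n + 1) / 1)
theorem4p2 n n≥1 =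
  /≡½* total number (n + 1) {{weaklyDecreasingPFs-nonEmpty n}} (begin
    2 ℕ.* total                   ≡⟨ cong (2 ℕ.*_) (trans
                                       (sum-map-weaklyDecreasingPFs numLucky (newValues n) numLucky≡newValues)
                                       (sumBallot-newValues n n ℕ.≤-refl)) ⟩
    2 ℕ.* totalNewValues n n      ≡⟨ 2*totalNewValues n n≥1 ⟩
    -- The length of the list is its sum of the constant 1, which the same reduction turns into T n
    -- n.
    suc n ℕ.* ballotNumber n n    ≡⟨ cong₂ ℕ._*_ (ℕ.+-comm 1 n) (sym (trans
                                       (length≡sum-map (weaklyDecreasingPFs n)) (trans
                                       (sum-map-weaklyDecreasingPFs {n} _ (λ _ → 1) (λ _ _ → refl))
                                       (sumBallot-one n n ℕ.≤-refl)))) ⟩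
    (n + 1) ℕ.* number            ∎)
  where
  open ≡-Reasoning
  total  = sum (map numLucky (weaklyDecreasingPFs n))
  number = length (weaklyDecreasingPFs n)
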